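{- Fix $m\ge 2$. Assume that for all $(s,k)$ an $m$-odd-even merger $\mathrm{oe\_merge}^s_k$ of order $k$ on $s$ inputs is given. Define recursively, for $1\le k\le n$, the comparator network $\mathrm{oe\_sel}^n_k$ on input $\bar x\in X^n$ as follows. If $k=1$: output $\max^n(\bar x)$. If $k\ge 2$: choose integers $n_1\ge\dots\ge n_m\ge 0$ with $\sum_i n_i=n$ and $n_1<n$. Split $\bar x$ into consecutive blocks $\bar x^1,\dots,\bar x^m$ of lengths $n_1,\dots,n_m$. For each $i$ let $k_i=\min(k,n_i)$ and $\bar y^i=\mathrm{oe\_sel}^{n_i}_{k_i}(\bar x^i)$ (with $\bar y^i=\bar x^i$ if $k_i=0$). Let $s=\sum_ik_i$ and $\overline{out}=\mathrm{suff}(k_1+1,\bar y^1)::\dots::\mathrm{suff}(k_m+1,\bar y^m)$. Output $\mathrm{oe\_merge}^s_k(\langle \mathrm{pref}(k_1,\bar y^1),\dots,\mathrm{pref}(k_m,\bar y^m)\rangle)::\overline{out}$. Then for every choice of the splittings, $\mathrm{oe\_sel}^n_k$ is a $k$-selection network, i.e. for every $\bar x\in X^n$ the output is top $k$ sorted.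
   Context: $X$ is a totally ordered set. A sequence is sorted if it is non-increasing. $::$ is concatenation; $\mathrm{pref}(i,\bar x)=\langle x_1,\dots,x_i\rangle$, $\mathrm{suff}(i,\bar x)=\langle x_i,\dots,x_n\rangle$ (empty if $i>n$). A comparator network is a map on sequences obtained by composing sorters (which rearrange the values at chosen positions into non-increasing order) and fixed rearrangements of positions; it permutes its input. $\max^n$ is a comparator network on $n$ inputs whose first output is the maximum of the inputs. A sequence $\bar x\in X^n$ is top $k$ sorted ($k\le n$) if $\langle x_1,\dots,x_k\rangle$ is sorted and $x_i\ge x_j$ for all $i\le k<j$; by convention a sequence of length at most $k$ is top $k$ sorted iff it is sorted. A $k$-selection network on $n$ inputs is a comparator network whose output is top $k$ sorted for every input. An $m$-odd-even merger of order $k$ on $s$ inputs is a comparator network $f$ such that for every tuple $\langle\bar x^1,\dots,\bar x^m\rangle$ in which each $\bar x^i$ is top $k$ sorted and $\sum_i|\bar x^i|=s$, $f(\bar x^1::\dots::\bar x^m)$ is top $k$ sorted. -}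

module Defs where

open import Data.Fin using (Fin; toℕ; zero; suc)
open import Data.Fin.Permutation using (Permutation′; _⟨$⟩ʳ_)
open import Data.Fin.Properties using (any?) renaming (_≟_ to _≟ᶠ_)
open import Data.Nat using (ℕ; zero; suc; pred; _+_; _∸_; _⊓_; _≤_; _<_; _≥_; z≤n; s≤s)
open import Data.Nat.Induction using (<-rec)
open import Data.Nat.Properties using (m⊓n≤n; m+[n∸m]≡n; ≤-<-trans)
open import Data.Nat.Tactic.RingSolver using (solve-∀)
open import Data.Product using (Σ; _×_; _,_)
open import Data.Sum using (inj₁; inj₂)
open import Data.Vec using (Vec; []; _∷_; _++_; sum; map; lookup; tabulate; take; drop; cast)
open import Data.Vec.Membership.Propositional using (_∈_)
open import Data.Vec.Relation.Unary.All as All using (All; []; _∷_)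
open import Data.Vec.Relation.Unary.All.Properties using (map⁺; lookup⁺)
open import Data.Vec.Relation.Unary.Linked using (Linked; []; [-]; _∷_)
open import Function using (_∘_; _↣_; Injection)
open import Level using (Level; _⊔_)
open import Relation.Binary using (TotalOrder)
open import Relation.Binary.PropositionalEquality using (_≡_; refl; sym; trans; cong₂)
open import Relation.Nullary using (yes; no)

private
  variable
    a : Level
    A : Set a
    m n k p : ℕ

-- ⟨x₁,…,x_min(k,n)⟩
pref : ∀ k → Vec A n → Vec A (k ⊓ n)
pref zero    xs       = []
pref (suc k) []       = []
pref (suc k) (x ∷ xs) = x ∷ pref k xs

-- ⟨xᵢ,…,xₙ⟩ with positions counted from 1; the index i = 0 is never used.
suff : ∀ i → Vec A n → Vec A (n ∸ pred i)
suff zero          xs       = xs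
suff (suc zero)    xs       = xs
suff (suc (suc i)) []       = []
suff (suc (suc i)) (x ∷ xs) = suff (suc i) xs

-- A tuple of sequences of lengths ns is an element of All (Vec A) ns.
join : {ns : Vec ℕ m} → All (Vec A) ns → Vec A (sum ns)
join []         = []
join (xs ∷ xss) = xs ++ join xss

blocks : (ns : Vec ℕ m) → Vec A (sum ns) → All (Vec A) ns
blocks []       xs = []
blocks (n ∷ ns) xs = take n xs ∷ blocks ns (drop n xs)

data Network (n : ℕ) : Set where
  sorter    : (Fin p ↣ Fin n) → Network n
  rearrange : Permutation′ n → Network n
  _⨾_       : Network n → Network n → Network n

record Splitting (m n : ℕ) : Set where
  field
    sizes         : Vec ℕ m
    nonincreasing : Linked _≥_ sizes
    total         : sum sizes ≡ n
    first<n       : ∀ (i : Fin m) → toℕ i ≡ 0 → lookup sizes i < n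

-- The tree of all choices made while unfolding the recursive definition of
-- the selection network: the splittings in different calls are unrelated,
-- even if the calls have the same n and k.
data Plan (m : ℕ) (n : ℕ) : ℕ → Set where
  idle  : Plan m n 0
  max   : Plan m n 1
  split : 2 ≤ k → (σ : Splitting m n) →
          All (λ nᵢ → Plan m nᵢ (k ⊓ nᵢ)) (Splitting.sizes σ) →
          Plan m n k

-- In particular, a splitting fixed for each pair (n, k) determines a plan.
planOf : (∀ n k → 2 ≤ k → k ≤ n → Splitting m n) → ∀ n k → k ≤ n → Plan m n k
planOf {m} choose = <-rec (λ n → ∀ k → k ≤ n → Plan m n k) step
  where
  all< : ∀ {m n} (ns : Vec ℕ m) → Linked _≥_ ns →
         (∀ i → toℕ i ≡ 0 → lookup ns i < n) → All (_< n) ns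
  all< []            _         h = []
  all< (x ∷ [])      _         h = h zero refl ∷ []
  all< (x ∷ y ∷ ns)  (x≥y ∷ l) h =
    h zero refl ∷ all< (y ∷ ns) l (λ { zero _ → ≤-<-trans x≥y (h zero refl) })

  step : ∀ n → (∀ {n′} → n′ < n → ∀ k → k ≤ n′ → Plan m n′ k) →
         ∀ k → k ≤ n → Plan m n k
  step n rec zero          k≤n = idle
  step n rec (suc zero)    k≤n = max
  step n rec k@(suc (suc _)) k≤n =
    split (s≤s (s≤s z≤n)) σ
      (All.map (λ {nᵢ} lt → rec lt (k ⊓ nᵢ) (m⊓n≤n k nᵢ))
               (all< sizes nonincreasing first<n))
    where
    σ = choose n k (s≤s (s≤s z≤n)) k≤n
    open Splitting σ

sum-pref-suff : ∀ k (ns : Vec ℕ m) →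
  sum (map (k ⊓_) ns) + sum (map (λ nᵢ → nᵢ ∸ (k ⊓ nᵢ)) ns) ≡ sum ns
sum-pref-suff k []       = refl
sum-pref-suff k (n ∷ ns) =
  trans (swap (k ⊓ n) (sum (map (k ⊓_) ns)) (n ∸ (k ⊓ n)) _)
        (cong₂ _+_ (m+[n∸m]≡n (m⊓n≤n k n)) (sum-pref-suff k ns))
  where
  swap : ∀ a b c d → (a + b) + (c + d) ≡ (a + c) + (b + d)
  swap = solve-∀

module Selection {c ℓ₁ ℓ₂} (O : TotalOrder c ℓ₁ ℓ₂) where

  open TotalOrder O using () renaming (Carrier to X; _≤_ to _≼_; _≥_ to _≽_; total to ≼-total)

  Sorted : Vec X n → Set (c ⊔ ℓ₂)
  Sorted = Linked _≽_

  insert : X → Vec X n → Vec X (suc n)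
  insert x []       = x ∷ []
  insert x (y ∷ ys) with ≼-total x y
  ... | inj₁ x≼y = y ∷ insert x ys
  ... | inj₂ y≼x = x ∷ y ∷ ys

  sort : Vec X n → Vec X n
  sort []       = []
  sort (x ∷ xs) = insert x (sort xs)

  sort-sorted : (xs : Vec X n) → Sorted (sort xs)
  sort-sorted []       = []
  sort-sorted (x ∷ xs) = insert-sorted x (sort xs) (sort-sorted xs)
    where
    insert-sorted : ∀ {n} x (ys : Vec X n) → Sorted ys → Sorted (insert x ys)
    insert-sorted x []       _ = [-]
    insert-sorted x (y ∷ ys) s with ≼-total x y
    insert-sorted x (y ∷ ys) s          | inj₂ y≼x = y≼x ∷ s
    insert-sorted x (y ∷ []) s          | inj₁ x≼y = x≼y ∷ [-]
    insert-sorted x (y ∷ z ∷ ys) (q ∷ s) | inj₁ x≼y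
      with ≼-total x z | insert-sorted x (z ∷ ys) s
    ... | inj₁ _ | r = q ∷ r
    ... | inj₂ _ | r = x≼y ∷ r

  -- Replaces the entry at position (pos j) by the j-th entry of vs.
  overwrite : (Fin p ↣ Fin n) → Vec X p → Vec X n → Vec X n
  overwrite pos vs xs = tabulate entry
    where
    entry : Fin _ → X
    entry i with any? (λ j → Injection.to pos j ≟ᶠ i)
    ... | yes (j , _) = lookup vs j
    ... | no _        = lookup xs i

  ⟦_⟧ : Network n → Vec X n → Vec X n
  ⟦ sorter pos ⟧  xs = overwrite pos (sort (tabulate (lookup xs ∘ Injection.to pos))) xs
  ⟦ rearrange π ⟧ xs = tabulate (λ i → lookup xs (π ⟨$⟩ʳ i))
  ⟦ f ⨾ g ⟧       xs = ⟦ g ⟧ (⟦ f ⟧ xs)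

  IsComparatorNetwork : (Vec X n → Vec X n) → Set c
  IsComparatorNetwork {n} f = Σ (Network n) λ N → ∀ xs → f xs ≡ ⟦ N ⟧ xs

  -- Indices in Fin n count from 0, so position i + 1 is among the first k iff
  -- toℕ i < k.  For n ≤ k, pref k xs is all of xs and the second condition is
  -- void, so this is then just sortedness.
  TopSorted : ℕ → Vec X n → Set (c ⊔ ℓ₂)
  TopSorted {n} k xs =
    Sorted (pref k xs) ×
    (∀ (i j : Fin n) → toℕ i < k → k ≤ toℕ j → lookup xs i ≽ lookup xs j)

  IsMaximum : X → Vec X n → Set (c ⊔ ℓ₂)
  IsMaximum y xs = y ∈ xs × All (_≼ y) xs

  IsMaxNetwork : (Vec X n → Vec X n) → Set (c ⊔ ℓ₂)
  IsMaxNetwork {n} f =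
    IsComparatorNetwork f ×
    (∀ xs (i : Fin n) → toℕ i ≡ 0 → IsMaximum (lookup (f xs) i) xs)

  IsSelectionNetwork : ℕ → (Vec X n → Vec X n) → Set (c ⊔ ℓ₂)
  IsSelectionNetwork k f = IsComparatorNetwork f × (∀ xs → TopSorted k (f xs))

  IsOddEvenMerger : (m k : ℕ) → (Vec X n → Vec X n) → Set (c ⊔ ℓ₂)
  IsOddEvenMerger {s} m k f =
    IsComparatorNetwork f ×
    (∀ (ns : Vec ℕ m) (eq : sum ns ≡ s) (xss : All (Vec X) ns) →
       (∀ i → TopSorted k (lookup⁺ xss i)) →
       TopSorted k (f (cast eq (join xss))))

  module OddEvenSelection
    (maxNet   : (n : ℕ) → Vec X n → Vec X n)
    (oe-merge : (s k : ℕ) → Vec X s → Vec X s)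
    where

    mutual
      oe-sel : Plan m n k → Vec X n → Vec X n
      oe-sel idle xs = xs
      oe-sel max  xs = maxNet _ xs
      oe-sel {k = k} (split _ σ plans) xs =
        cast (trans (sum-pref-suff k sizes) total)
          (oe-merge s k (join prefs) ++ out)
        where
        open Splitting σ
        ys    = oe-sels plans (blocks sizes (cast (sym total) xs))
        s     = sum (map (k ⊓_) sizes)
        prefs = map⁺ (All.map (pref k) ys)
        out   = join (map⁺ {f = λ nᵢ → nᵢ ∸ (k ⊓ nᵢ)}
                       (All.map (λ {nᵢ} → suff (suc (k ⊓ nᵢ))) ys))

      oe-sels : {M : ℕ} {ns : Vec ℕ m} →
                All (λ nᵢ → Plan M nᵢ (k ⊓ nᵢ)) ns → All (Vec X) ns → All (Vec X) ns
      oe-sels []             []         = []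
      oe-sels (plan ∷ plans) (xs ∷ xss) = oe-sel plan xs ∷ oe-sels plans xss

{-# OPTIONS --safe #-}

-- Correctness of the split step.  The merged sequence z is top k sorted, so
-- only the entries w of the discarded suffixes need care.  If w comes from
-- block i, then that block is longer than k and the k entries of its prefix
-- dominate w; they all occur, at distinct positions, in z.  A set of k
-- positions of z cannot lie before position i < k, so one of these entries
-- sits at or after i, whence zᵢ dominates it and therefore w.
--
-- That the construction is a comparator network is shown with a relation F ⟶ G
-- ("a fixed network turns F t into G t, for all t") on families of sequences;
-- its closure under composition and concatenation absorbs the bookkeeping of
-- lengths and positions.

module Submission where

open import Data.Fin as Fin using (Fin; toℕ; zero; suc; _↑ˡ_; _↑ʳ_; splitAt; inject≤)
open import Data.Fin.Permutation using (Permutation; _⟨$⟩ʳ_; _⟨$⟩ˡ_; inverseʳ; ↔⇒≡)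
open import Data.Fin.Properties using
  (_≟_; any?; injective⇒≤; injective⇒existsPivot; punchOut-injective; splitAt⁻¹-↑ˡ;
   splitAt⁻¹-↑ʳ; splitAt-↑ˡ; splitAt-↑ʳ; splitAt-join; suc-injective; ↑ˡ-injective;
   ↑ʳ-injective; toℕ-↑ˡ; toℕ-↑ʳ; +↔⊎; toℕ-injective; toℕ-fromℕ<; toℕ-inject≤; inject≤-injective;
   toℕ-cast; toℕ<n)
open import Data.Nat using (ℕ; zero; suc; _+_; _∸_; _⊓_; _≤_; _<_; z≤n; s≤s)
open import Data.Nat.Properties as ℕ using (+-assoc; m⊓n≤n; ⊓-glb; m+[n∸m]≡n; 1+n≰n)
open import Data.Product using (∃; _×_; _,_; proj₁; proj₂)
open import Data.Sum using (_⊎_; inj₁; inj₂; [_,_]′)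
open import Data.Sum.Function.Propositional using (_⊎-↔_)
open import Data.Sum.Properties using (swap-↔)
open import Data.Vec using (Vec; []; _∷_; _++_; sum; map; lookup; tabulate; take; drop; cast)
open import Data.Vec.Properties using
  (cast-sym; tabulate∘lookup; lookup∘tabulate; tabulate-cong; cast-is-id; lookup-splitAt;
   lookup-++ˡ; lookup-++ʳ; lookup-cast₁; ++-assoc-eqFree; take++drop≡id)
open import Data.Vec.Relation.Unary.All as All using (All; []; _∷_)
open import Data.Vec.Relation.Unary.All.Properties using (map⁺; lookup⁺)
open import Data.Vec.Relation.Unary.Linked using ([]; [-]; _∷_)
import Data.Vec.Relation.Unary.Linked.Properties as Linked
open import Function using (_∘_; id; _↣_; mk↣; Injection; Inverse; _↔_)
open import Function.Construct.Composition using (_↣-∘_; _↔-∘_)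
open import Function.Construct.Identity using (↣-id; ↔-id)
open import Function.Construct.Symmetry using (↔-sym)
open import Function.Definitions using (Injective)
open import Function.Properties.Inverse using (↔⇒↣)
open import Level using (Level; _⊔_)
open import Relation.Binary using (TotalOrder)
open import Relation.Binary.PropositionalEquality using (_≡_; _≢_; refl; sym; trans; cong; subst; subst₂)
open import Relation.Nullary using (yes; no; contradiction)
open import Defs

private
  variable
    a t : Level
    A : Set a
    k m n p q : ℕ

-- Positions, prefixes and suffixes

-- If `j` were missed, punching it out of the codomain would inject `Fin (suc n)` into `Fin n`.
injective⇒surjective : {f : Fin n → Fin n} → Injective _≡_ _≡_ f → ∀ j → ∃ λ i → f i ≡ j
injective⇒surjective {suc n} {f} inj j with any? (λ i → f i ≟ j)
... | yes hit  = hit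
... | no  miss = contradiction (injective⇒≤ (inj ∘ punchOut-injective (missed _) (missed _))) 1+n≰n
  where
  missed : ∀ i → j ≢ f i
  missed i eq = miss (i , sym eq)

-- Matching on this view turns an index of a concatenation into the literal form `i ↑ˡ n` or
-- `m ↑ʳ i`, to which the lookup lemmas for `_++_` apply.
data SplitView (m : ℕ) {n : ℕ} : Fin (m + n) → Set where
  left  : (i : Fin m) → SplitView m (i ↑ˡ n)
  right : (i : Fin n) → SplitView m (m ↑ʳ i)

splitView : ∀ m (i : Fin (m + n)) → SplitView m i
splitView m i with splitAt m i in eq
... | inj₁ j = subst (SplitView m) (splitAt⁻¹-↑ˡ eq) (left j)
... | inj₂ j = subst (SplitView m) (splitAt⁻¹-↑ʳ eq) (right j)

lookup-ext : {xs ys : Vec A n} → (∀ i → lookup xs i ≡ lookup ys i) → xs ≡ ys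
lookup-ext {xs = xs} {ys} eq =
  trans (sym (tabulate∘lookup xs)) (trans (tabulate-cong eq) (tabulate∘lookup ys))

-- Truncation at `k` is subadditive. For `k ≤ sum ns` this says that the truncated blocks still give
-- the merger at least `k` inputs.
⊓-sum≤sum-⊓ : ∀ k (ns : Vec ℕ m) → k ⊓ sum ns ≤ sum (map (k ⊓_) ns)
⊓-sum≤sum-⊓ k []       = ℕ.≤-reflexive (ℕ.⊓-zeroʳ k)
⊓-sum≤sum-⊓ k (n ∷ ns) =
  ℕ.≤-trans (⊓-subadditive k n (sum ns)) (ℕ.+-monoʳ-≤ (k ⊓ n) (⊓-sum≤sum-⊓ k ns))
  where
  ⊓-subadditive : ∀ k m n → k ⊓ (m + n) ≤ k ⊓ m + k ⊓ n
  ⊓-subadditive zero    m       n = z≤n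
  ⊓-subadditive (suc k) zero    n = ℕ.≤-refl
  ⊓-subadditive (suc k) (suc m) n =
    s≤s (ℕ.≤-trans (⊓-subadditive k m n) (ℕ.+-monoʳ-≤ (k ⊓ m) (ℕ.⊓-monoˡ-≤ n (ℕ.n≤1+n k))))

lookup-pref : ∀ k (xs : Vec A n) i → lookup (pref k xs) i ≡ lookup xs (inject≤ i (m⊓n≤n k n))
lookup-pref (suc k) (x ∷ xs) zero    = refl
lookup-pref (suc k) (x ∷ xs) (suc i) = lookup-pref k xs i

lookup-suff : ∀ q (xs : Vec A n) j → ∃ λ i → q ≤ toℕ i × lookup (suff (suc q) xs) j ≡ lookup xs i
lookup-suff zero    xs       j = j , z≤n , refl
lookup-suff (suc q) (x ∷ xs) j with i , q≤i , eq ← lookup-suff q xs j = suc i , s≤s q≤i , eq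

cast≡pref++suff : ∀ k (xs : Vec A n) →
  cast (sym (m+[n∸m]≡n (m⊓n≤n k n))) xs ≡ pref k xs ++ suff (suc (k ⊓ n)) xs
cast≡pref++suff zero    xs       = cast-is-id refl xs
cast≡pref++suff (suc k) []       = refl
cast≡pref++suff (suc k) (x ∷ xs) = cong (x ∷_) (cast≡pref++suff k xs)

-- Sub-multisets

infix 4 _⊑_

-- Inclusion with multiplicity, witnessed by positions, so that distinct entries stay distinct when
-- followed through a network. Between equal lengths the embedding is a bijection, hence `xs ⊑ f xs`
-- expresses that `f` permutes `xs`.
record _⊑_ {A : Set a} (xs : Vec A m) (ys : Vec A n) : Set a where
  constructor embed
  field
    embedding : Fin m ↣ Fin n
    preserves : ∀ i → lookup ys (Injection.to embedding i) ≡ lookup xs i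

⊑-refl : {xs : Vec A n} → xs ⊑ xs
⊑-refl = embed (↣-id _) λ _ → refl

⊑-trans : {xs : Vec A m} {ys : Vec A n} {zs : Vec A p} → xs ⊑ ys → ys ⊑ zs → xs ⊑ zs
⊑-trans (embed ρ eq) (embed ρ′ eq′) = embed (ρ′ ↣-∘ ρ) λ i → trans (eq′ _) (eq i)

++ˡ-⊑ : (xs : Vec A m) (ys : Vec A n) → xs ⊑ xs ++ ys
++ˡ-⊑ {n = n} xs ys = embed (mk↣ {to = _↑ˡ n} (↑ˡ-injective n _ _)) (lookup-++ˡ xs ys)

++ʳ-⊑ : (xs : Vec A m) (ys : Vec A n) → ys ⊑ xs ++ ys
++ʳ-⊑ {m = m} xs ys = embed (mk↣ {to = m ↑ʳ_} (↑ʳ-injective m _ _)) (lookup-++ʳ xs ys)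

∷-⊑ : ∀ x {xs : Vec A m} {ys : Vec A n} → xs ⊑ ys → x ∷ xs ⊑ x ∷ ys
∷-⊑ x (embed ρ eq) = embed (mk↣ inj) λ { zero → refl ; (suc i) → eq i }
  where
  to : Fin (suc _) → Fin (suc _)
  to zero    = zero
  to (suc i) = suc (Injection.to ρ i)

  inj : Injective _≡_ _≡_ to
  inj {zero}  {zero}  _  = refl
  inj {zero}  {suc j} ()
  inj {suc i} {zero}  ()
  inj {suc i} {suc j} eq = cong suc (Injection.injective ρ (suc-injective eq))

swap-⊑ : ∀ x y {xs : Vec A n} → x ∷ y ∷ xs ⊑ y ∷ x ∷ xs
swap-⊑ x y = embed (mk↣ inj) λ { zero → refl ; (suc zero) → refl ; (suc (suc i)) → refl }
  where
  to : Fin (suc (suc _)) → Fin (suc (suc _))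
  to zero          = suc zero
  to (suc zero)    = zero
  to (suc (suc i)) = suc (suc i)

  inj : Injective _≡_ _≡_ to
  inj {zero}        {zero}        refl = refl
  inj {zero}        {suc zero}    ()
  inj {zero}        {suc (suc j)} ()
  inj {suc zero}    {suc zero}    refl = refl
  inj {suc (suc i)} {suc (suc j)} refl = refl

module _ {c ℓ₁ ℓ₂} (O : TotalOrder c ℓ₁ ℓ₂) where

  open TotalOrder O using ()
    renaming (Carrier to X; _≥_ to _≽_; total to ≼-total; refl to ≼-refl; trans to ≼-trans)
  open Selection O

  -- Comparator networks permute their input

  insert-⊑ : ∀ x (ys : Vec X n) → x ∷ ys ⊑ insert x ys
  insert-⊑ x []       = ⊑-refl
  insert-⊑ x (y ∷ ys) with ≼-total x y
  ... | inj₁ _ = ⊑-trans (swap-⊑ x y) (∷-⊑ y (insert-⊑ x ys))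
  ... | inj₂ _ = ⊑-refl

  sort-⊑ : (xs : Vec X n) → xs ⊑ sort xs
  sort-⊑ []       = ⊑-refl
  sort-⊑ (x ∷ xs) = ⊑-trans (∷-⊑ x (sort-⊑ xs)) (insert-⊑ x (sort xs))

  module _ (pos : Fin p ↣ Fin n) (vs : Vec X p) (xs : Vec X n) where

    -- The right-hand side is the local function of overwrite, which cannot be named here.
    private
      overwrite-entry : ∀ i → lookup (overwrite pos vs xs) i ≡ _
      overwrite-entry i = lookup∘tabulate _ i

    lookup-overwrite-hit : ∀ j {i} → Injection.to pos j ≡ i →
                           lookup (overwrite pos vs xs) i ≡ lookup vs j
    lookup-overwrite-hit j {i} eq rewrite overwrite-entry i
      with any? (λ j → Injection.to pos j ≟ i)
    -- The search may return another preimage `j′` of `i`; injectivity of `pos` identifies it with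
    -- `j`.
    ... | yes (j′ , eq′) = cong (lookup vs) (Injection.injective pos (trans eq′ (sym eq)))
    ... | no  miss       = contradiction (j , eq) miss

    lookup-overwrite-miss : ∀ i → (∀ j → Injection.to pos j ≢ i) →
                            lookup (overwrite pos vs xs) i ≡ lookup xs i
    lookup-overwrite-miss i miss rewrite overwrite-entry i
      with any? (λ j → Injection.to pos j ≟ i)
    ... | yes (j , eq) = contradiction eq (miss j)
    ... | no  _        = refl

  -- Positions in the image of `pos` are permuted among themselves by `τ`; all others stay fixed.
  overwrite-⊑ : ∀ (pos : Fin p ↣ Fin n) {vs} (xs : Vec X n) →
                tabulate (lookup xs ∘ Injection.to pos) ⊑ vs → xs ⊑ overwrite pos vs xs
  overwrite-⊑ pos {vs} xs (embed τ eq) = embed (mk↣ inj) values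
    where
    open Injection pos using () renaming (to to at; injective to at-injective)

    to : Fin _ → Fin _
    to i with any? (λ j → at j ≟ i)
    ... | yes (j , _) = at (Injection.to τ j)
    ... | no  _       = i

    inj : Injective _≡_ _≡_ to
    inj {i} {i′} e with any? (λ j → at j ≟ i) | any? (λ j → at j ≟ i′)
    ... | yes (j , refl) | yes (j′ , refl) = cong at (Injection.injective τ (at-injective e))
    -- A chosen and an unchosen position cannot collide: the first is sent into the image of `pos`,
    -- the second remains outside it.
    ... | yes (j , _)    | no  miss        = contradiction (_ , e) miss
    ... | no  miss       | yes (j , _)     = contradiction (_ , sym e) miss
    ... | no  _          | no  _           = e

    values : ∀ i → lookup (overwrite pos vs xs) (to i) ≡ lookup xs i
    values i with any? (λ j → at j ≟ i)
    ... | yes (j , refl) = trans (lookup-overwrite-hit pos vs xs (Injection.to τ j) refl)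
                                 (trans (eq j) (lookup∘tabulate _ j))
    ... | no  miss       = lookup-overwrite-miss pos vs xs i (λ j e → miss (j , e))

  network-⊑ : (N : Network n) (xs : Vec X n) → xs ⊑ ⟦ N ⟧ xs
  network-⊑ (sorter pos)  xs = overwrite-⊑ pos xs (sort-⊑ _)
  -- Output position `j` reads input position `π ⟨$⟩ʳ j`, so the entries themselves travel along the
  -- inverse of `π`.
  network-⊑ (rearrange π) xs =
    embed (↔⇒↣ (↔-sym π)) λ i → trans (lookup∘tabulate _ (π ⟨$⟩ˡ i)) (cong (lookup xs) (inverseʳ π))
  network-⊑ (f ⨾ g)       xs = ⊑-trans (network-⊑ f xs) (network-⊑ g (⟦ f ⟧ xs))

  comparator-⊑ : {f : Vec X n → Vec X n} → IsComparatorNetwork f → ∀ xs → xs ⊑ f xs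
  comparator-⊑ (N , eq) xs = subst (xs ⊑_) (sym (eq xs)) (network-⊑ N xs)

  -- Constructing networks

  infix 4 _⟶_

  -- One network must serve all `t`. The length of the target is an index, so sequences of different
  -- length expressions can be related, and matching on `net` unifies the two lengths.
  data _⟶_ {T : Set t} (F : T → Vec X m) : (T → Vec X n) → Set (t ⊔ c) where
    net : {G : T → Vec X m} (N : Network m) → (∀ t → G t ≡ ⟦ N ⟧ (F t)) → F ⟶ G

  module _ {T : Set t} where

    private
      variable
        F G H : T → Vec X n

    ⟶-trans : F ⟶ G → G ⟶ H → F ⟶ H
    ⟶-trans (net N eq) (net M eq′) = net (N ⨾ M) λ t → trans (eq′ t) (cong ⟦ M ⟧ (eq t))

    -- A bijection of the index sets forces `n` and `m` to be equal; after that identification `π`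
    -- is itself a network.
    reindex : {F : T → Vec X m} {G : T → Vec X n} (π : Permutation n m) →
              (∀ t j → lookup (G t) j ≡ lookup (F t) (π ⟨$⟩ʳ j)) → F ⟶ G
    reindex {F = F} π eq with refl ← ↔⇒≡ π =
      net (rearrange π) λ t → lookup-ext λ j → trans (eq t j) (sym (lookup∘tabulate _ j))

    ⟶-cast : {F : T → Vec X m} {G : T → Vec X n} (eq : m ≡ n) → (∀ t → cast eq (F t) ≡ G t) → F ⟶ G
    ⟶-cast refl eq = reindex (↔-id _) λ t j →
      cong (λ xs → lookup xs j) (trans (sym (eq t)) (cast-is-id refl _))

    ⟶-reflexive : (∀ t → F t ≡ G t) → F ⟶ G
    ⟶-reflexive eq = ⟶-cast refl λ t → trans (cast-is-id refl _) (eq t)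

    ⟶-refl : F ⟶ F
    ⟶-refl = ⟶-reflexive λ _ → refl

    infixr 5 _⊕_

    _⊕_ : (T → Vec X m) → (T → Vec X n) → T → Vec X (m + n)
    (F ⊕ G) t = F t ++ G t

    -- Conjugation with `splitAt` and `join` allows a permutation of a concatenation to be given on
    -- the disjoint union of the index sets.
    reindex-⊕ : (F : T → Vec X m) (G : T → Vec X n) (H : T → Vec X p) (K : T → Vec X q) →
                (π : (Fin p ⊎ Fin q) ↔ (Fin m ⊎ Fin n)) →
                (∀ t j → [ lookup (H t) , lookup (K t) ]′ j ≡
                         [ lookup (F t) , lookup (G t) ]′ (Inverse.to π j)) →
                F ⊕ G ⟶ H ⊕ K
    reindex-⊕ {m} {n} {p} F G H K π eq =
      reindex (↔-sym +↔⊎ ↔-∘ (π ↔-∘ +↔⊎)) λ t j →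
        trans (lookup-splitAt p (H t) (K t) j)
        (trans (eq t (splitAt p j))
        (sym (trans (lookup-splitAt m (F t) (G t) (Fin.join m n (Inverse.to π (splitAt p j))))
                    (cong [ lookup (F t) , lookup (G t) ]′
                          (splitAt-join m n (Inverse.to π (splitAt p j)))))))

    ⊕-comm : (F : T → Vec X m) (G : T → Vec X n) → F ⊕ G ⟶ G ⊕ F
    ⊕-comm F G = reindex-⊕ F G G F swap-↔ λ { t (inj₁ j) → refl ; t (inj₂ j) → refl }

    -- The same wiring runs on the first `m` of `m + n` inputs: sorter positions are moved along
    -- `_↑ˡ n`, and `π` is extended by the identity.
    network-⊕ : (N : Network m) (F : T → Vec X m) (H : T → Vec X n) → F ⊕ H ⟶ (⟦ N ⟧ ∘ F) ⊕ H
    network-⊕ {m} {n} (sorter {p} pos) F H = net (sorter pos′) λ t → lookup-ext (values t)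
      where
      pos′ : Fin p ↣ Fin (m + n)
      pos′ = mk↣ {to = _↑ˡ n} (↑ˡ-injective n _ _) ↣-∘ pos

      values : ∀ t i → lookup (⟦ sorter pos ⟧ (F t) ++ H t) i ≡ lookup (⟦ sorter pos′ ⟧ (F t ++ H t)) i
      -- `lemma` overwrites with the same sorted `vs` on both sides. It then remains that `pos′`
      -- selects from the concatenation what `pos` selects from `F t`.
      values t i = trans (lemma (splitView m i))
        (cong (λ vs → lookup (overwrite pos′ (sort vs) (F t ++ H t)) i)
              (sym (tabulate-cong λ j → lookup-++ˡ (F t) (H t) (Injection.to pos j))))
        where
        vs : Vec X p
        vs = sort (tabulate (lookup (F t) ∘ Injection.to pos))

        lemma : ∀ {i} → SplitView m i →
                lookup (overwrite pos vs (F t) ++ H t) i ≡ lookup (overwrite pos′ vs (F t ++ H t)) i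
        lemma (left i) with any? (λ j → Injection.to pos j ≟ i)
        ... | yes (j , refl) = trans (lookup-++ˡ (overwrite pos vs (F t)) (H t) i)
          (trans (lookup-overwrite-hit pos vs (F t) j refl)
                 (sym (lookup-overwrite-hit pos′ vs (F t ++ H t) j refl)))
        ... | no miss = trans (lookup-++ˡ (overwrite pos vs (F t)) (H t) i)
          (trans (lookup-overwrite-miss pos vs (F t) i λ j e → miss (j , e))
          (trans (sym (lookup-++ˡ (F t) (H t) i))
          (sym (lookup-overwrite-miss pos′ vs (F t ++ H t) (i ↑ˡ n)
                 λ j e → miss (j , ↑ˡ-injective n _ _ e)))))
        -- No position `m ↑ʳ i` is hit by `pos′`, since `splitAt` puts the two on different sides.
        lemma (right i) = trans (lookup-++ʳ (overwrite pos vs (F t)) (H t) i)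
          (trans (sym (lookup-++ʳ (F t) (H t) i))
          (sym (lookup-overwrite-miss pos′ vs (F t ++ H t) (m ↑ʳ i) λ j e →
            contradiction (trans (sym (splitAt-↑ˡ m _ n)) (trans (cong (splitAt m) e) (splitAt-↑ʳ m n i)))
                          λ ())))
    network-⊕ (rearrange π) F H = reindex-⊕ F H (⟦ rearrange π ⟧ ∘ F) H (π ⊎-↔ ↔-id _)
      λ { t (inj₁ j) → lookup∘tabulate _ j ; t (inj₂ j) → refl }
    network-⊕ (f ⨾ g) F H = ⟶-trans (network-⊕ f F H) (network-⊕ g (⟦ f ⟧ ∘ F) H)

    ⊕-congˡ : {F : T → Vec X m} {G : T → Vec X n} (H : T → Vec X p) → F ⟶ G → F ⊕ H ⟶ G ⊕ H
    ⊕-congˡ {F = F} H (net N eq) =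
      ⟶-trans (network-⊕ N F H) (⟶-reflexive λ t → cong (_++ H t) (sym (eq t)))

    ⊕-congʳ : (H : T → Vec X p) {F : T → Vec X m} {G : T → Vec X n} → F ⟶ G → H ⊕ F ⟶ H ⊕ G
    ⊕-congʳ H {F} {G} F⟶G = ⟶-trans (⊕-comm H F) (⟶-trans (⊕-congˡ H F⟶G) (⊕-comm G H))

    ⊕-assocʳ : (F : T → Vec X m) (G : T → Vec X n) (H : T → Vec X p) → (F ⊕ G) ⊕ H ⟶ F ⊕ (G ⊕ H)
    ⊕-assocʳ {m} {n} {p} F G H = ⟶-cast (+-assoc m n p) λ t → ++-assoc-eqFree (F t) (G t) (H t)

    ⊕-assocˡ : (F : T → Vec X m) (G : T → Vec X n) (H : T → Vec X p) → F ⊕ (G ⊕ H) ⟶ (F ⊕ G) ⊕ H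
    ⊕-assocˡ {m} {n} {p} F G H =
      ⟶-cast (sym (+-assoc m n p)) λ t → cast-sym (+-assoc m n p) (++-assoc-eqFree (F t) (G t) (H t))

    -- Serves to collect the prefixes of all blocks in front of all suffixes, one block at a time.
    ⊕-interchange : (F : T → Vec X m) (G : T → Vec X n) (H : T → Vec X p) (K : T → Vec X q) →
                    (F ⊕ G) ⊕ (H ⊕ K) ⟶ (F ⊕ H) ⊕ (G ⊕ K)
    ⊕-interchange F G H K =
      ⟶-trans (⊕-assocʳ F G (H ⊕ K))
      (⟶-trans (⊕-congʳ F (⟶-trans (⊕-assocˡ G H K)
                 (⟶-trans (⊕-congˡ K (⊕-comm G H)) (⊕-assocʳ H G K))))
      (⊕-assocˡ F H (G ⊕ K)))

  ⟶-∘ : ∀ {u} {T : Set t} {U : Set u} {F : T → Vec X m} {G : T → Vec X n} (h : U → T) →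
        F ⟶ G → F ∘ h ⟶ G ∘ h
  ⟶-∘ h (net N eq) = net N (eq ∘ h)

  comparator⇒⟶ : {f : Vec X n → Vec X n} → IsComparatorNetwork f → id ⟶ f
  comparator⇒⟶ (N , eq) = net N eq

  ⟶⇒comparator : {f : Vec X n → Vec X n} → id ⟶ f → IsComparatorNetwork f
  ⟶⇒comparator (net N eq) = N , eq

  -- Top sortedness

  -- Both halves of `TopSorted k` in one condition on positions. It does not mention `pref`, which
  -- makes it easy to carry through casts and concatenations.
  Dominating : ℕ → Vec X n → Set ℓ₂
  Dominating {n} k xs = ∀ (i j : Fin n) → toℕ i < k → toℕ i ≤ toℕ j → lookup xs i ≽ lookup xs j

  topSorted⇒dominating : ∀ k (xs : Vec X n) → TopSorted k xs → Dominating k xs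
  topSorted⇒dominating {n} k xs (sorted , dom) i j i<k i≤j with k ℕ.≤? toℕ j
  ... | yes k≤j = dom i j i<k k≤j
  ... | no  k≰j with ℕ.m≤n⇒m<n∨m≡n i≤j
  ...   | inj₂ i≡j = subst (λ j → lookup xs i ≽ lookup xs j) (toℕ-injective i≡j) ≼-refl
  -- Both positions lie in the prefix, where transitivity extends the comparisons of neighbours to
  -- all pairs.
  ...   | inj₁ i<j = subst₂ _≽_ (restrict i i<k) (restrict j j<k)
    (Linked.lookup⁺ (λ x≽y y≽z → ≼-trans y≽z x≽y) sorted
      (subst₂ _<_ (sym (toℕ-fromℕ< _)) (sym (toℕ-fromℕ< _)) i<j))
    where
    j<k : toℕ j < k
    j<k = ℕ.≰⇒> k≰j

    bound : (i : Fin n) → toℕ i < k → toℕ i < k ⊓ n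
    bound i i<k = ⊓-glb i<k (toℕ<n i)

    restrict : ∀ i (i<k : toℕ i < k) → lookup (pref k xs) (Fin.fromℕ< (bound i i<k)) ≡ lookup xs i
    restrict i i<k = trans (lookup-pref k xs _)
      (cong (lookup xs) (toℕ-injective (trans (toℕ-inject≤ _ _) (toℕ-fromℕ< (bound i i<k)))))

  dominating⇒topSorted : ∀ k (xs : Vec X n) → Dominating k xs → TopSorted k xs
  dominating⇒topSorted k xs dom =
    sorted k xs dom , λ i j i<k k≤j → dom i j i<k (ℕ.<⇒≤ (ℕ.<-≤-trans i<k k≤j))
    where
    sorted : ∀ {n} k (xs : Vec X n) → Dominating k xs → Sorted (pref k xs)
    sorted zero          xs           dom = []
    sorted (suc k)       []           dom = []
    sorted (suc zero)    (x ∷ xs)     dom = [-]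
    sorted (suc (suc k)) (x ∷ [])     dom = [-]
    sorted (suc (suc k)) (x ∷ y ∷ xs) dom =
      dom zero (suc zero) (s≤s z≤n) z≤n ∷
      sorted (suc k) (y ∷ xs) λ i j i<k i≤j → dom (suc i) (suc j) (s≤s i<k) (s≤s i≤j)

  -- A block is selected at order `k ⊓ n`, but the merger asks for order `k`. Every position of the
  -- prefix is below `k ⊓ n`, so the stronger order comes for free.
  pref-dominating : ∀ k (xs : Vec X n) → Dominating (k ⊓ n) xs → Dominating k (pref k xs)
  pref-dominating {n} k xs dom i j _ i≤j =
    subst₂ _≽_ (sym (lookup-pref k xs i)) (sym (lookup-pref k xs j))
      (dom (inject≤ i _) (inject≤ j _)
        (subst (_< k ⊓ n) (sym (toℕ-inject≤ i _)) (toℕ<n i))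
        (subst₂ _≤_ (sym (toℕ-inject≤ i _)) (sym (toℕ-inject≤ j _)) i≤j))

  cast-dominating : ∀ .(eq : m ≡ n) (xs : Vec X m) → Dominating k xs → Dominating k (cast eq xs)
  cast-dominating {k = k} eq xs dom i j i<k i≤j =
    subst₂ _≽_ (sym (lookup-cast₁ eq xs i)) (sym (lookup-cast₁ eq xs j))
      (dom _ _ (subst (_< k) (sym (toℕ-cast (sym eq) i)) i<k)
               (subst₂ _≤_ (sym (toℕ-cast (sym eq) i)) (sym (toℕ-cast (sym eq) j)) i≤j))

  -- Elements below `k` entries of a sequence

  -- The `k` entries are given by an injection of positions, so equal values are counted separately
  -- and the count survives any embedding `_⊑_`.
  record Majorised (k : ℕ) (w : X) (xs : Vec X n) : Set ℓ₂ where
    constructor majorised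
    field
      positions : Fin k ↣ Fin n
      above     : ∀ i → lookup xs (Injection.to positions i) ≽ w

  majorised-⊑ : ∀ {w} {xs : Vec X m} {ys : Vec X n} → Majorised k w xs → xs ⊑ ys → Majorised k w ys
  majorised-⊑ {w = w} (majorised ρ ge) (embed ρ′ eq) =
    majorised (ρ′ ↣-∘ ρ) λ i → subst (_≽ w) (sym (eq _)) (ge i)

  dominating∧majorised : ∀ {w} (xs : Vec X n) → Dominating k xs → Majorised k w xs →
                         ∀ i → toℕ i < k → lookup xs i ≽ w
  dominating∧majorised xs dom (majorised ρ ge) i i<k
    -- The `i + 1` positions up to `i` cannot all be sent strictly below `i` by an injection; the
    -- pivot `j` is one that is not.
    with j , _ , i≤ρj ← injective⇒existsPivot (Injection.injective ρ) (Fin.fromℕ< i<k) =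
    ≼-trans (ge j) (dom i _ i<k (subst (_≤ _) (toℕ-fromℕ< i<k) i≤ρj))

  -- As `k ≤ m`, the first `k` positions all lie in `xs`. Against `xs` they are compared by `dom`,
  -- against `ys` by majorisation.
  ++-dominating : (xs : Vec X m) (ys : Vec X n) → k ≤ m → Dominating k xs →
                  (∀ j → Majorised k (lookup ys j) xs) → Dominating k (xs ++ ys)
  ++-dominating {m} {n} {k} xs ys k≤m dom maj i j i<k i≤j = lemma (splitView m i) (splitView m j) i<k i≤j
    where
    lemma : ∀ {i j} → SplitView m i → SplitView m j → toℕ i < k → toℕ i ≤ toℕ j →
            lookup (xs ++ ys) i ≽ lookup (xs ++ ys) j
    lemma (left i) (left j) i<k i≤j
      rewrite lookup-++ˡ xs ys i | lookup-++ˡ xs ys j | toℕ-↑ˡ i n | toℕ-↑ˡ j n = dom i j i<k i≤j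
    lemma (left i) (right j) i<k _
      rewrite lookup-++ˡ xs ys i | lookup-++ʳ xs ys j | toℕ-↑ˡ i n =
      dominating∧majorised xs dom (maj j) i i<k
    lemma (right i) _ i<k _ rewrite toℕ-↑ʳ m i =
      contradiction (ℕ.<-≤-trans i<k k≤m) (ℕ.≤⇒≯ (ℕ.m≤m+n m (toℕ i)))

  pref-majorises-suff : ∀ k (xs : Vec X n) → Dominating (k ⊓ n) xs →
                        ∀ j → Majorised k (lookup (suff (suc (k ⊓ n)) xs) j) (pref k xs)
  pref-majorises-suff {n} k xs dom j with i , k⊓n≤i , eq ← lookup-suff (k ⊓ n) xs j =
    majorised (mk↣ {to = λ h → inject≤ h k≤k⊓n} (inject≤-injective k≤k⊓n k≤k⊓n _ _)) λ h →
      subst₂ _≽_ (sym (lookup-pref k xs _)) (sym eq) (dom _ i (bound h) (ℕ.<⇒≤ (ℕ.<-≤-trans (bound h) k⊓n≤i)))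
    where
    -- The suffix has an entry, at a position `i` with `k ⊓ n ≤ i < n`. This excludes `n ≤ k`, so
    -- the prefix has its full `k` entries.
    k≤k⊓n : k ≤ k ⊓ n
    k≤k⊓n with ℕ.≤-total k n
    ... | inj₁ k≤n = ⊓-glb ℕ.≤-refl k≤n
    ... | inj₂ n≤k = contradiction (ℕ.≤-<-trans k⊓n≤i (toℕ<n i)) (ℕ.≤⇒≯ (⊓-glb n≤k ℕ.≤-refl))

    bound : ∀ h → toℕ (inject≤ (inject≤ h k≤k⊓n) (m⊓n≤n k n)) < k ⊓ n
    bound h = subst (_< k ⊓ n) (sym (toℕ-inject≤ _ _)) (toℕ<n (inject≤ h k≤k⊓n))

  module _
    (M : ℕ)
    (maxNet : (n : ℕ) → Vec X n → Vec X n)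
    (isMax : ∀ n → IsMaxNetwork (maxNet n))
    (oe-merge : (s k : ℕ) → Vec X s → Vec X s)
    (isMerger : ∀ s k → IsOddEvenMerger M k (oe-merge s k))
    where

    open OddEvenSelection maxNet oe-merge

    prefs : ∀ k {ns : Vec ℕ m} → All (Vec X) ns → All (Vec X) (map (k ⊓_) ns)
    prefs k yss = map⁺ (All.map (pref k) yss)

    suffs : ∀ k {ns : Vec ℕ m} → All (Vec X) ns → All (Vec X) (map (λ nᵢ → nᵢ ∸ (k ⊓ nᵢ)) ns)
    suffs k yss = map⁺ {f = λ nᵢ → nᵢ ∸ (k ⊓ nᵢ)} (All.map (λ {nᵢ} → suff (suc (k ⊓ nᵢ))) yss)

    -- The construction is a comparator network

    mutual
      -- Four stages: cast, recursive calls with prefixes gathered in front, the merger on the left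
      -- summand alone, and a final cast.
      oe-sel-network : (plan : Plan M n k) → id ⟶ oe-sel plan
      oe-sel-network idle = ⟶-refl
      oe-sel-network max  = comparator⇒⟶ (proj₁ (isMax _))
      oe-sel-network {k = k} (split _ σ plans) =
        ⟶-trans (⟶-cast (sym total) λ _ → refl)
        (⟶-trans (⟶-∘ (cast (sym total)) (oe-sels-network plans))
        (⟶-trans (⊕-congˡ (join ∘ suffs k ∘ outputs)
                    (⟶-∘ (join ∘ prefs k ∘ outputs) (comparator⇒⟶ (proj₁ (isMerger _ k)))))
        (⟶-cast (trans (sum-pref-suff k sizes) total) λ _ → refl)))
        where
        open Splitting σ

        outputs : Vec X _ → All (Vec X) sizes
        outputs xs = oe-sels plans (blocks sizes (cast (sym total) xs))

      -- The first block is processed and cut in two, the remaining blocks are processed by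
      -- recursion, and `⊕-interchange` brings the two prefix parts together.
      oe-sels-network : {ns : Vec ℕ m} (plans : All (λ nᵢ → Plan M nᵢ (k ⊓ nᵢ)) ns) →
        id ⟶ λ xs → join (prefs k (oe-sels plans (blocks ns xs))) ++
                     join (suffs k (oe-sels plans (blocks ns xs)))
      oe-sels-network [] = ⟶-reflexive λ { [] → refl }
      oe-sels-network {k = k} {n ∷ ns} (plan ∷ plans) =
        ⟶-trans (⟶-reflexive λ xs → sym (take++drop≡id n xs))
        (⟶-trans (⊕-congˡ (drop n) (⟶-∘ (take n) (⟶-trans (oe-sel-network plan)
                    (⟶-cast (sym (m+[n∸m]≡n (m⊓n≤n k n))) λ xs → cast≡pref++suff k (oe-sel plan xs)))))
        (⟶-trans (⊕-congʳ (first ⊕ second) (⟶-∘ (drop n) (oe-sels-network plans)))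
        (⊕-interchange first second (join ∘ prefs k ∘ rest) (join ∘ suffs k ∘ rest))))
        where
        first : Vec X (n + sum ns) → Vec X (k ⊓ n)
        first = pref k ∘ oe-sel plan ∘ take n

        second : Vec X (n + sum ns) → Vec X (n ∸ (k ⊓ n))
        second = suff (suc (k ⊓ n)) ∘ oe-sel plan ∘ take n

        rest : Vec X (n + sum ns) → All (Vec X) ns
        rest = oe-sels plans ∘ blocks ns ∘ drop n

    -- The output is top sorted

    mutual
      oe-sel-dominating : (plan : Plan M n k) → k ≤ n → ∀ xs → Dominating k (oe-sel plan xs)
      oe-sel-dominating idle k≤n xs i j () _
      oe-sel-dominating max  k≤n xs i j i<1 _
        -- The maximum is compared with inputs, while domination concerns outputs. Since the network
        -- permutes, output position `j` holds the input entry at some `h`.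
        with isNet , maximum ← isMax _
        with embed ρ eq ← comparator-⊑ isNet xs
        with h , refl ← injective⇒surjective (Injection.injective ρ) j =
        subst (lookup (maxNet _ xs) i ≽_) (sym (eq h))
          (lookup⁺ (proj₂ (maximum xs i (ℕ.n<1⇒n≡0 i<1))) h)
      oe-sel-dominating {n} {k} (split _ σ plans) k≤n xs =
        cast-dominating _ (oe-merge _ k (join (prefs k yss)) ++ join (suffs k yss))
          (++-dominating (oe-merge _ k (join (prefs k yss))) (join (suffs k yss)) k≤s merged
            -- Majorisation is known for the input of the merger and passes to its output, which is
            -- a permutation of that input.
            λ j → majorised-⊑ (suffs-majorised plans xss j) (comparator-⊑ (proj₁ (isMerger _ k)) _))
        where
        open Splitting σ

        xss : All (Vec X) sizes
        xss = blocks sizes (cast (sym total) xs)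

        yss : All (Vec X) sizes
        yss = oe-sels plans xss

        k≤s : k ≤ sum (map (k ⊓_) sizes)
        k≤s = ℕ.≤-trans (⊓-glb ℕ.≤-refl (ℕ.≤-trans k≤n (ℕ.≤-reflexive (sym total))))
                        (⊓-sum≤sum-⊓ k sizes)

        merged : Dominating k (oe-merge _ k (join (prefs k yss)))
        -- The specification of a merger casts its input, here along `refl`; the `subst` removes
        -- this cast.
        merged = subst (λ zs → Dominating k (oe-merge _ k zs)) (cast-is-id refl _)
          (topSorted⇒dominating k _
            (proj₂ (isMerger _ k) (map (k ⊓_) sizes) refl (prefs k yss) (prefs-topSorted plans xss)))

      prefs-topSorted : {ns : Vec ℕ m} (plans : All (λ nᵢ → Plan M nᵢ (k ⊓ nᵢ)) ns) →
        ∀ xss i → TopSorted k (lookup⁺ (prefs k (oe-sels plans xss)) i)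
      prefs-topSorted {k = k} {n ∷ _} (plan ∷ plans) (xs ∷ xss) zero =
        dominating⇒topSorted k _ (pref-dominating k _ (oe-sel-dominating plan (m⊓n≤n k n) xs))
      prefs-topSorted (plan ∷ plans) (xs ∷ xss) (suc i) = prefs-topSorted plans xss i

      -- The prefix of an entry's own block already majorises it, and appending the prefixes of the
      -- other blocks only adds positions.
      suffs-majorised : {ns : Vec ℕ m} (plans : All (λ nᵢ → Plan M nᵢ (k ⊓ nᵢ)) ns) →
        ∀ xss j → Majorised k (lookup (join (suffs k (oe-sels plans xss))) j)
                              (join (prefs k (oe-sels plans xss)))
      suffs-majorised {k = k} {n ∷ ns} (plan ∷ plans) (xs ∷ xss) j = lemma (splitView _ j)
        where
        ys : Vec X n
        ys = oe-sel plan xs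

        yss : All (Vec X) ns
        yss = oe-sels plans xss

        lemma : ∀ {j} → SplitView (n ∸ (k ⊓ n)) j →
                Majorised k (lookup (suff (suc (k ⊓ n)) ys ++ join (suffs k yss)) j)
                            (pref k ys ++ join (prefs k yss))
        lemma (left j) rewrite lookup-++ˡ (suff (suc (k ⊓ n)) ys) (join (suffs k yss)) j =
          majorised-⊑ (pref-majorises-suff k ys (oe-sel-dominating plan (m⊓n≤n k n) xs) j)
            (++ˡ-⊑ (pref k ys) (join (prefs k yss)))
        lemma (right j) rewrite lookup-++ʳ (suff (suc (k ⊓ n)) ys) (join (suffs k yss)) j =
          majorised-⊑ (suffs-majorised plans xss j)
            (++ʳ-⊑ (pref k ys) (join (prefs k yss)))

mainTheorem4 :
    ∀ {c ℓ₁ ℓ₂ : Level} (O : TotalOrder c ℓ₁ ℓ₂) →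
    let open TotalOrder O using () renaming (Carrier to X)
        open Selection O in
    (m : ℕ) → 2 ≤ m →
    (maxNet : (n : ℕ) → Vec X n → Vec X n) →
    (∀ n → IsMaxNetwork (maxNet n)) →
    (oe-merge : (s k : ℕ) → Vec X s → Vec X s) →
    (∀ s k → IsOddEvenMerger m k (oe-merge s k)) →
    let open OddEvenSelection maxNet oe-merge in
    ∀ (n k : ℕ) → 1 ≤ k → k ≤ n →
    (plan : Plan m n k) →
    IsSelectionNetwork k (oe-sel plan)
mainTheorem4 O m _ maxNet isMax oe-merge isMerger n k _ k≤n plan =
  ⟶⇒comparator O (oe-sel-network O m maxNet isMax oe-merge isMerger plan) ,
  λ xs → dominating⇒topSorted O k _ (oe-sel-dominating O m maxNet isMax oe-merge isMerger plan k≤n xs)
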